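{- Let $\ell\ge3$. If $\lambda$ is an $(\ell,0)$-JM partition, then $\lambda$ is a node of the ladder crystal $B(\Lambda_0)^L$.
   Context: $h^\lambda_{(a,b)}$ is the hook length of the box in row $a$, column $b$: the number of boxes of $\lambda$ to the right of and below $(a,b)$ (same row or column), including $(a,b)$. A partition $\lambda$ is an $(\ell,0)$-JM partition if there do not exist boxes $(a,b),(a,y),(x,b)$ in its Young diagram with $\ell\mid h^\lambda_{(a,b)}$, $\ell\nmid h^\lambda_{(a,y)}$ and $\ell\nmid h^\lambda_{(x,b)}$. Ladder crystal. The position $(a,b)$ (row $a$, column $b$) has residue $b-a\bmod\ell$. The ladder of $(a,b)$ is the set of positions $(c,d)$, $c,d\ge1$, with $c-a=(\ell-1)(b-d)$; all its positions have the same residue, and it is an $i$-ladder if that residue is $i$. Ladders are ordered left to right, i.e. by increasing value of $a+(\ell-1)(b-1)$. A box of $\lambda$ of residue $i$ whose removal leaves a partition is a removable $i$-box; a position of residue $i$ not in $\lambda$ whose addition gives a partition is an addable $i$-box. Given a partition $\lambda$ and $0\le i<\ell$, label each addable $i$-box $+$ and each removable $i$-box $-$; the ladder $i$-signature is the word read from leftmost $i$-ladder to rightmost $i$-ladder, and from top to bottom on each ladder. Repeatedly cancel adjacent pairs $-+$ to get the reduced ladder $i$-signature $+\cdots+-\cdots-$. $\widehat f_i\lambda$ is $\lambda$ together with the box of the rightmost remaining $+$ (or $0$ if there is none). The nodes of $B(\Lambda_0)^L$ are the partitions obtained from the empty partition $\emptyset$ by applying finite sequences of the operators $\widehat f_i$,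 $0\le i<\ell$. -}

module Defs where

open import Data.Fin using (Fin; toℕ)
open import Data.Integer as ℤ using (ℤ)
import Data.Integer.Divisibility as ℤ
open import Data.List using (List; []; _∷_; _++_; drop; filter; length)
open import Data.List.Membership.Propositional using (_∈_)
open import Data.List.Relation.Unary.All using (All; [])
open import Data.List.Relation.Unary.AllPairs using (AllPairs)
open import Data.List.Relation.Unary.Linked using (Linked; [])
open import Data.Nat using (ℕ; zero; suc; _+_; _*_; _∸_; _<_; _≥_; _<?_)
open import Data.Nat.Divisibility using (_∣_; _∤_)
open import Data.Product using (∃; ∃-syntax; _×_; _,_; proj₁; proj₂)
open import Data.Sign using (Sign)
open import Data.Sum using (_⊎_)
open import Function using (_on_)
open import Function.Bundles using (_⇔_)
open import Relation.Binary.Construct.Closure.ReflexiveTransitive using (Star)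
open import Relation.Binary.PropositionalEquality using (_≡_)
open import Relation.Nullary using (¬_)

record Partition : Set where
  constructor mkPartition
  field
    parts      : List ℕ
    decreasing : Linked _≥_ parts
    positive   : All (0 <_) parts

open Partition public

∅ : Partition
∅ = mkPartition [] [] []

-- Rows and columns are counted from 0, so (a , b) stands for the position
-- usually written (a+1 , b+1).  Residues, hooks and the order on ladders
-- are unaffected by this shift.
Position : Set
Position = ℕ × ℕ

nth : List ℕ → ℕ → ℕ
nth []       _       = 0
nth (x ∷ _)  zero    = x
nth (_ ∷ xs) (suc a) = nth xs a

row : Partition → ℕ → ℕ
row μ = nth (parts μ)

infix 4 _∈ᴰ_

_∈ᴰ_ : Position → Partition → Set
(a , b) ∈ᴰ μ = b < row μ a

-- The boxes strictly to the right of (a , b), then those strictly below it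
-- (one for each lower row that reaches column b), then (a , b) itself.
-- Meaningful only when (a , b) ∈ᴰ μ.
arm leg hook : Partition → ℕ → ℕ → ℕ
arm  μ a b = row μ a ∸ suc b
leg  μ a b = length (filter (b <?_) (drop (suc a) (parts μ)))
hook μ a b = arm μ a b + leg μ a b + 1

IsJM : ℕ → Partition → Set
IsJM ℓ μ = ¬ (∃[ a ] ∃[ b ] ∃[ x ] ∃[ y ]
  ((a , b) ∈ᴰ μ × (a , y) ∈ᴰ μ × (x , b) ∈ᴰ μ ×
   ℓ ∣ hook μ a b × ℓ ∤ hook μ a y × ℓ ∤ hook μ x b))

HasResidue : (ℓ : ℕ) → Fin ℓ → Position → Set
HasResidue ℓ i (a , b) = ℤ.+ ℓ ℤ.∣ (ℤ.+ b ℤ.- ℤ.+ a) ℤ.- ℤ.+ (toℕ i)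

-- c - a = (ℓ-1)(b - d) holds iff (a , b) and (c , d) have the same index, so
-- the ladders are the fibres of this map, and they are ordered by its value.
ladder : ℕ → Position → ℕ
ladder ℓ (a , b) = a + (ℓ ∸ 1) * b

Precedes : ℕ → Position → Position → Set
Precedes ℓ p q =
  ladder ℓ p < ladder ℓ q ⊎ (ladder ℓ p ≡ ladder ℓ q × proj₁ p < proj₁ q)

AddsBox : Partition → Position → Partition → Set
AddsBox μ p ν = ¬ (p ∈ᴰ μ) × (∀ q → q ∈ᴰ ν ⇔ (q ∈ᴰ μ ⊎ q ≡ p))

Addable Removable : Partition → Position → Set
Addable   μ p = ∃[ ν ] AddsBox μ p ν
Removable μ p = ∃[ ν ] AddsBox ν p μ

-- Each letter remembers the position it labels.
Word : Set
Word = List (Sign × Position)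

record IsSignature (ℓ : ℕ) (i : Fin ℓ) (μ : Partition) (w : Word) : Set where
  field
    ordered : AllPairs (Precedes ℓ on proj₂) w
    plus    : ∀ p → (Sign.+ , p) ∈ w ⇔ (HasResidue ℓ i p × Addable μ p)
    minus   : ∀ p → (Sign.- , p) ∈ w ⇔ (HasResidue ℓ i p × Removable μ p)

infix 4 _↝_

data _↝_ : Word → Word → Set where
  cancel : ∀ u {p q} v → u ++ (Sign.- , p) ∷ (Sign.+ , q) ∷ v ↝ u ++ v

IsReduction : Word → Word → Set
IsReduction w r = Star _↝_ w r × (∀ r′ → ¬ (r ↝ r′))

IsReducedSignature : (ℓ : ℕ) → Fin ℓ → Partition → Word → Set
IsReducedSignature ℓ i μ r = ∃[ w ] (IsSignature ℓ i μ w × IsReduction w r)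

RightmostPlus : Word → Position → Set
RightmostPlus r p =
  ∃[ u ] ∃[ v ] (r ≡ u ++ (Sign.+ , p) ∷ v × All (λ s → proj₁ s ≡ Sign.-) v)

-- The graph of the partial operator: f̂ ℓ i μ ν says that applying the i-th
-- operator to μ gives ν, and the value is 0 when no such ν exists.  The
-- signature is determined by its order and its letters, and cancellation is
-- confluent, so the relation is functional.
f̂ : (ℓ : ℕ) → Fin ℓ → Partition → Partition → Set
f̂ ℓ i μ ν =
  ∃[ r ] ∃[ p ] (IsReducedSignature ℓ i μ r × RightmostPlus r p × AddsBox μ p ν)

IsLadderNode : ℕ → Partition → Set
IsLadderNode ℓ = Star (λ μ ν → ∃[ i ] f̂ ℓ i μ ν) ∅

{-# OPTIONS --safe #-}

-- In a JM partition every addable i-box precedes every removable i-box in the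
-- ladder order, so the ladder i-signature is +⋯+-⋯- without any cancellation,
-- and the removable i-boxes can be taken off one by one, leftmost first, each
-- removal undoing one application of the i-th operator.  On the Maya diagram
-- (beads row a - a - 1) this moves every bead of residue i with a gap just
-- before it into that gap, and the result is again JM.  Induct on the size.
module Submission where

open import Defs
open import Data.Empty using (⊥)
open import Data.Fin using (Fin; toℕ; fromℕ<)
open import Data.Fin.Properties using (toℕ-fromℕ<)
open import Data.Integer as ℤ using (ℤ; 1ℤ; +≤+; +<+)
import Data.Integer.DivMod as ℤ
import Data.Integer.Divisibility as ℤ
import Data.Integer.Divisibility.Signed as Signed
import Data.Integer.Properties as ℤ
open import Data.Integer.Tactic.RingSolver using (solve-∀)
open import Data.List using (List; []; _∷_; _++_; [_]; map; drop; length; filter; upTo; cartesianProduct)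
open import Data.List.Membership.Propositional using (_∈_; _∉_)
open import Data.List.Membership.Propositional.Properties
  using (∈-++⁺ˡ; ∈-++⁺ʳ; ∈-++⁻; ∈-map⁺; ∈-map⁻; ∈-filter⁺; ∈-filter⁻; ∈-cartesianProduct⁺; ∈-upTo⁺)
open import Data.List.Properties using (map-++; ++-assoc; ∷-injective; filter-accept; filter-reject)
open import Data.List.Relation.Unary.All as All using (All; []; _∷_)
import Data.List.Relation.Unary.All.Properties as All
open import Data.List.Relation.Unary.AllPairs using (AllPairs; []; _∷_)
import Data.List.Relation.Unary.AllPairs.Properties as AllPairs
open import Data.List.Relation.Unary.Any using (here; there)
open import Data.List.Relation.Unary.Linked using (Linked; []; [-]; _∷_; tail)
open import Data.Nat
open import Data.Nat.Divisibility using (_∣_; _∤_; divides; _∣?_; ∣1⇒≡1)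
open import Data.Nat.Induction using (<-rec)
open import Data.Nat.ListAction using (sum)
open import Data.Nat.Properties
open import Data.Nat.Solver using (module +-*-Solver)
open import Data.Product using (∃-syntax; _×_; _,_; proj₁; proj₂)
open import Data.Sign using (Sign)
open import Data.Sum using (_⊎_; inj₁; inj₂)
open import Function using (_∘_)
open import Function.Bundles using (_⇔_; mk⇔; Equivalence)
open import Function.Construct.Composition using (_⇔-∘_)
open import Relation.Binary using (tri<; tri≈; tri>)
open import Relation.Binary.Construct.Closure.ReflexiveTransitive using (Star; ε; _◅_; _◅◅_)
open import Relation.Binary.PropositionalEquality hiding ([_])
open import Relation.Nullary using (¬_; Dec; yes; no; contradiction)
open import Relation.Nullary.Decidable using (map′; _×-dec_; decidable-stable)
open import Relation.Unary using (Decidable)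

open Equivalence using (to; from)

-- The removable i-boxes are treated as one block because the partitions in between need not be JM:
-- for ℓ = 3 the core (5,3,1) has three removable boxes of residue 1, and on the way to (4,2) it
-- passes through (5,3) and then (5,2), which is not JM. Two invariants survive single removals
-- instead. `Letters` keeps the shape of the signature: the leftmost minus turns into a plus at the
-- same place, so the list of positions does not change and the box just removed carries the
-- rightmost plus. `Sorts` compares the current beads with those of the original partition, and JM
-- is transferred only once, when no removable i-box is left. The transfer is done on Maya diagrams
-- because a hook length is there a bead minus a smaller gap: JM becomes a statement about residues,
-- symmetric under exchanging beads with gaps and reversing the line.

-- Rows, columns and hook lengths.

nth-antitone-suc : ∀ {xs} → Linked _≥_ xs → ∀ a → nth xs (suc a) ≤ nth xs a
nth-antitone-suc []      a       = z≤n
nth-antitone-suc [-]     a       = z≤n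
nth-antitone-suc (r ∷ l) zero    = r
nth-antitone-suc (r ∷ l) (suc a) = nth-antitone-suc l a

nth≤head : ∀ {x xs} → Linked _≥_ (x ∷ xs) → ∀ a → nth xs a ≤ x
nth≤head l zero    = nth-antitone-suc l 0
nth≤head l (suc a) = ≤-trans (nth-antitone-suc l (suc a)) (nth≤head l a)

row-antitone : ∀ μ {a c} → a ≤ c → row μ c ≤ row μ a
row-antitone μ = go ∘ ≤⇒≤′
  where
  go : ∀ {a c} → a ≤′ c → row μ c ≤ row μ a
  go ≤′-refl       = ≤-refl
  go (≤′-step a≤c) = ≤-trans (nth-antitone-suc (decreasing μ) _) (go a≤c)

nth-beyond : ∀ xs {a} → length xs ≤ a → nth xs a ≡ 0
nth-beyond []       _         = refl
nth-beyond (x ∷ xs) (s≤s n≤a) = nth-beyond xs n≤a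

col : Partition → ℕ → ℕ
col μ b = length (filter (b <?_) (parts μ))

filter-length-≤ : ∀ {xs b} → Linked _≥_ xs → ∀ a → nth xs a ≤ b → length (filter (b <?_) xs) ≤ a
filter-length-≤ [] a _ = z≤n
filter-length-≤ {x ∷ xs} {b} l zero x≤b rewrite filter-reject (b <?_) {x} {xs} (≤⇒≯ x≤b) =
  filter-length-≤ (tail l) 0 (≤-trans (nth-antitone-suc l 0) x≤b)
filter-length-≤ {x ∷ xs} {b} l (suc a) h with b <? x
... | yes b<x rewrite filter-accept (b <?_) {x} {xs} b<x = s≤s (filter-length-≤ (tail l) a h)
... | no b≮x rewrite filter-reject (b <?_) {x} {xs} b≮x = m≤n⇒m≤1+n (filter-length-≤ (tail l) a h)

-- Rows decrease weakly, so each of the `suc a` rows removed by `drop` also reaches column `b`; they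
-- are exactly what the leg lacks to the full column.
filter-drop-length : ∀ {xs b} → Linked _≥_ xs → ∀ a → b < nth xs a →
  length (filter (b <?_) (drop (suc a) xs)) + suc a ≡ length (filter (b <?_) xs)
filter-drop-length {x ∷ xs} {b} l zero b<x rewrite filter-accept (b <?_) {x} {xs} b<x =
  +-comm _ 1
filter-drop-length {x ∷ xs} {b} l (suc a) h
  rewrite filter-accept (b <?_) {x} {xs} (<-≤-trans h (nth≤head l a)) =
  trans (+-suc _ _) (cong suc (filter-drop-length (tail l) a h))

row≤⇒col≤ : ∀ μ {a b} → row μ a ≤ b → col μ b ≤ a
row≤⇒col≤ μ {a} = filter-length-≤ (decreasing μ) a

∈ᴰ⇒<col : ∀ μ {a b} → b < row μ a → a < col μ b
∈ᴰ⇒<col μ {a} {b} h = subst (a <_) (filter-drop-length (decreasing μ) a h) (m≤n+m (suc a) _)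

hook-formula : ∀ μ {a b} → b < row μ a → hook μ a b + (a + suc b) ≡ row μ a + col μ b
hook-formula μ {a} {b} h = begin
  arm μ a b + leg μ a b + 1 + (a + suc b)   ≡⟨ solve 4 (λ r g a b → r :+ g :+ con 1 :+ (a :+ (con 1 :+ b)) := (r :+ (con 1 :+ b)) :+ (g :+ (con 1 :+ a))) refl (arm μ a b) (leg μ a b) a b ⟩
  (arm μ a b + suc b) + (leg μ a b + suc a) ≡⟨ cong₂ _+_ (m∸n+n≡m h) (filter-drop-length (decreasing μ) a h) ⟩
  row μ a + col μ b                         ∎
  where
  open ≡-Reasoning
  open +-*-Solver

-- Changing one row; addable and removable boxes in terms of row lengths.

∷-linked : ∀ {x xs} → nth xs 0 ≤ x → Linked _≥_ xs → Linked _≥_ (x ∷ xs)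
∷-linked {xs = []}    _ _ = [-]
∷-linked {xs = _ ∷ _} h l = h ∷ l

-- Parts are positive, so the list has to end at the first zero of `f`; `n` only bounds the
-- recursion.
fromRows : ∀ (f : ℕ → ℕ) n → (∀ a → f (suc a) ≤ f a) → f n ≡ 0 →
  ∃[ ν ] ∀ a → row ν a ≡ f a
fromRows f n anti fn≡0 with f 0 in f0≡
... | zero = ∅ , λ a → sym (vanish a)
  where
  vanish : ∀ a → f a ≡ 0
  vanish zero    = f0≡
  vanish (suc a) = n≤0⇒n≡0 (subst (f (suc a) ≤_) (vanish a) (anti a))
fromRows f zero anti fn≡0 | suc x = contradiction (trans (sym f0≡) fn≡0) λ ()
fromRows f (suc n) anti fn≡0 | suc x with fromRows (f ∘ suc) n (anti ∘ suc) fn≡0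
... | ν , eq = mkPartition (suc x ∷ parts ν)
                 (∷-linked (subst (_≤ suc x) (sym (eq 0)) (subst (f 1 ≤_) f0≡ (anti 0))) (decreasing ν))
                 (z<s ∷ positive ν)
             , λ { zero → sym f0≡ ; (suc a) → eq a }

setRow : ∀ μ a v → (∀ x → x < a → v ≤ row μ x) → row μ (suc a) ≤ v →
  ∃[ ν ] (row ν a ≡ v × ∀ x → x ≢ a → row ν x ≡ row μ x)
setRow μ a v above below = ν , trans (ν≡f a) f-at , λ x x≢a → trans (ν≡f x) (f-off x≢a)
  where
  f : ℕ → ℕ
  f x with x ≟ a
  ... | yes _ = v
  ... | no  _ = row μ x

  f-at : f a ≡ v
  f-at with a ≟ a
  ... | yes _ = refl
  ... | no a≢a = contradiction refl a≢a

  f-off : ∀ {x} → x ≢ a → f x ≡ row μ x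
  f-off {x} x≢a with x ≟ a
  ... | yes x≡a = contradiction x≡a x≢a
  ... | no _ = refl

  f-antitone : ∀ x → f (suc x) ≤ f x
  f-antitone x with suc x ≟ a | x ≟ a
  ... | yes refl | yes x≡a  = contradiction (sym x≡a) 1+n≢n
  ... | yes refl | no _     = above x ≤-refl
  ... | no _     | yes refl = below
  ... | no _     | no _     = row-antitone μ (n≤1+n x)

  -- Past the changed row and past the last part, so `f n` is an unmodified zero.
  n = suc (a + length (parts μ))

  built = fromRows f n f-antitone
    (trans (f-off (>⇒≢ (s≤s (m≤m+n a _)))) (nth-beyond (parts μ) (m≤n⇒m≤1+n (m≤n+m _ a))))
  ν = proj₁ built
  ν≡f = proj₂ built

rows⇒AddsBox : ∀ {μ ν a b} → row μ a ≡ b → row ν a ≡ suc b → (∀ x → x ≢ a → row ν x ≡ row μ x) →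
  AddsBox μ (a , b) ν
rows⇒AddsBox {μ} {ν} {a} {b} μa νa other = (λ b<r → <-irrefl (sym μa) b<r) , λ q → mk⇔ (fwd q) (bwd q)
  where
  fwd : ∀ q → q ∈ᴰ ν → q ∈ᴰ μ ⊎ q ≡ (a , b)
  fwd (x , y) h with x ≟ a
  ... | no x≢a = inj₁ (subst (y <_) (other x x≢a) h)
  ... | yes refl with m<1+n⇒m<n∨m≡n (subst (y <_) νa h)
  ...   | inj₁ y<b = inj₁ (subst (y <_) (sym μa) y<b)
  ...   | inj₂ refl = inj₂ refl
  bwd : ∀ q → q ∈ᴰ μ ⊎ q ≡ (a , b) → q ∈ᴰ ν
  bwd (x , y) (inj₂ refl) = subst (y <_) (sym νa) ≤-refl
  bwd (x , y) (inj₁ h) with x ≟ a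
  ... | no x≢a = subst (y <_) (sym (other x x≢a)) h
  ... | yes refl = subst (y <_) (sym νa) (m<n⇒m<1+n (subst (y <_) μa h))

<-ext : ∀ {m n} → (∀ y → y < m ⇔ y < n) → m ≡ n
<-ext {m} {n} h = ≤-antisym (≮⇒≥ λ n<m → <-irrefl refl (to (h n) n<m))
                            (≮⇒≥ λ m<n → <-irrefl refl (from (h m) m<n))

-- Forms of `Addable` and `Removable` that mention no second partition, hence decidable and easy to
-- transport when a row changes.
AddableSite RemovableSite : Partition → Position → Set
AddableSite   μ (c , d) = row μ c ≡ d × (∀ {x} → x < c → d < row μ x)
RemovableSite μ (a , b) = row μ a ≡ suc b × row μ (suc a) ≤ b

module _ {μ ν a b} (adds : AddsBox μ (a , b) ν) where

  new∈ : (a , b) ∈ᴰ ν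
  new∈ = from (proj₂ adds _) (inj₂ refl)

  old⊆ : ∀ q → q ∈ᴰ μ → q ∈ᴰ ν
  old⊆ q = from (proj₂ adds q) ∘ inj₁

  ≢new⇒old : ∀ q → q ∈ᴰ ν → q ≢ (a , b) → q ∈ᴰ μ
  ≢new⇒old q h q≢ with to (proj₂ adds q) h
  ... | inj₁ h′ = h′
  ... | inj₂ q≡ = contradiction q≡ q≢

  addableSite : AddableSite μ (a , b)
  addableSite = ≤-antisym (≮⇒≥ (proj₁ adds)) (≮⇒≥ left) ,
    λ {x} x<a → ≢new⇒old (x , b) (<-≤-trans new∈ (row-antitone ν (<⇒≤ x<a))) (<⇒≢ x<a ∘ cong proj₁)
    where
    left : ¬ row μ a < b
    left r<b = <-irrefl refl (≢new⇒old (a , row μ a) (<-trans r<b new∈) (<⇒≢ r<b ∘ cong proj₂))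

  removableSite : RemovableSite ν (a , b)
  removableSite = ≤-antisym (≮⇒≥ right) new∈ , ≮⇒≥ below
    where
    right : ¬ suc b < row ν a
    right h = proj₁ adds (<-trans (n<1+n b) (≢new⇒old (a , suc b) h (1+n≢n ∘ cong proj₂)))
    below : ¬ b < row ν (suc a)
    below h = proj₁ adds (<-≤-trans (≢new⇒old (suc a , b) h (1+n≢n ∘ cong proj₁)) (row-antitone μ (n≤1+n a)))

  other-rows : ∀ x → x ≢ a → row ν x ≡ row μ x
  other-rows x x≢a = <-ext λ y → mk⇔ (λ h → ≢new⇒old (x , y) h (x≢a ∘ cong proj₁)) (old⊆ (x , y))

AddableSite⇒Addable : ∀ μ {p} → AddableSite μ p → Addable μ p
AddableSite⇒Addable μ {c , d} (end , above)
  with ν , at , off ← setRow μ c (suc d) (λ x → above)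
                        (m≤n⇒m≤1+n (subst (_ ≤_) end (row-antitone μ (n≤1+n c))))
  = ν , rows⇒AddsBox {μ} {ν} end at off

RemovableSite⇒Removable : ∀ μ {p} → RemovableSite μ p → Removable μ p
RemovableSite⇒Removable μ {a , b} (end , below)
  with ν , at , off ← setRow μ a b
      (λ x x<a → ≤-trans (n≤1+n b) (subst (_≤ row μ x) end (row-antitone μ (<⇒≤ x<a)))) below
  = ν , rows⇒AddsBox {ν} {μ} at end (λ x x≢a → sym (off x x≢a))

-- Size, the measure of the induction.

size : Partition → ℕ
size = sum ∘ parts

sum-mono-≤ : ∀ xs ys → (∀ a → nth xs a ≤ nth ys a) → sum xs ≤ sum ys
sum-mono-≤ []       ys       h = z≤n
sum-mono-≤ (x ∷ xs) []       h = +-mono-≤ (h 0) (sum-mono-≤ xs [] (h ∘ suc))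
sum-mono-≤ (x ∷ xs) (y ∷ ys) h = +-mono-≤ (h 0) (sum-mono-≤ xs ys (h ∘ suc))

sum-mono-< : ∀ xs ys a → (∀ x → nth xs x ≤ nth ys x) → nth xs a < nth ys a → sum xs < sum ys
sum-mono-< []       (y ∷ ys) zero    h lt = <-≤-trans lt (m≤m+n y _)
sum-mono-< []       (y ∷ ys) (suc a) h lt = <-≤-trans (sum-mono-< [] ys a (λ _ → z≤n) lt) (m≤n+m _ y)
sum-mono-< (x ∷ xs) (y ∷ ys) zero    h lt = +-mono-<-≤ lt (sum-mono-≤ xs ys (h ∘ suc))
sum-mono-< (x ∷ xs) (y ∷ ys) (suc a) h lt = +-mono-≤-< (h 0) (sum-mono-< xs ys a (h ∘ suc) lt)

size-< : ∀ {μ ν p} → AddsBox μ p ν → size μ < size ν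
size-< {μ} {ν} {a , b} adds = sum-mono-< (parts μ) (parts ν) a pointwise at
  where
  at : row μ a < row ν a
  at = ≤-reflexive (trans (cong suc (proj₁ (addableSite {μ} {ν} adds))) (sym (proj₁ (removableSite {μ} {ν} adds))))
  pointwise : ∀ x → row μ x ≤ row ν x
  pointwise x with x ≟ a
  ... | yes refl = <⇒≤ at
  ... | no x≢a = ≤-reflexive (sym (other-rows {μ} {ν} adds x x≢a))

strict-descent : ∀ x xs → All (0 <_) (x ∷ xs) → ∃[ a ] nth (x ∷ xs) (suc a) < nth (x ∷ xs) a
strict-descent x []       (0<x ∷ []) = 0 , 0<x
strict-descent x (y ∷ ys) (_ ∷ 0<ys) with a , lt ← strict-descent y ys 0<ys = suc a , lt

-- Residues, and the JM condition for sets of beads.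

module Congruence (ℓ : ℕ) where

  infix 4 _≈_ _≈?_

  -- Wrapped in a record because divisibility unfolds to absolute values, from which `x` and `y`
  -- could not be inferred.
  record _≈_ (x y : ℤ) : Set where
    constructor mk≈
    field divisible : ℤ.+ ℓ ℤ.∣ x ℤ.- y

  open _≈_ public

  _≈?_ : ∀ x y → Dec (x ≈ y)
  x ≈? y = map′ mk≈ divisible (ℓ ∣? ℤ.∣ x ℤ.- y ∣)

  private
    signed : ∀ {x y} → x ≈ y → ℤ.+ ℓ Signed.∣ x ℤ.- y
    signed {x} {y} h = Signed.∣ᵤ⇒∣ {ℤ.+ ℓ} {x ℤ.- y} (divisible h)

    unsigned : ∀ {x y d} → d ≡ x ℤ.- y → ℤ.+ ℓ Signed.∣ d → x ≈ y
    unsigned refl h = mk≈ (Signed.∣⇒∣ᵤ h)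

  ≈-refl : ∀ {x} → x ≈ x
  ≈-refl {x} = unsigned (sym (ℤ.+-inverseʳ x)) (Signed.divides ℤ.0ℤ refl)

  ≈-sym : ∀ {x y} → x ≈ y → y ≈ x
  ≈-sym {x} {y} h = unsigned (eq x y) (Signed.∣m⇒∣-m (signed h))
    where
    eq : ∀ x y → ℤ.- (x ℤ.- y) ≡ y ℤ.- x
    eq = solve-∀

  ≈-trans : ∀ {x y z} → x ≈ y → y ≈ z → x ≈ z
  ≈-trans {x} {y} {z} h k = unsigned (eq x y z) (Signed.∣m∣n⇒∣m+n (signed h) (signed k))
    where
    eq : ∀ x y z → (x ℤ.- y) ℤ.+ (y ℤ.- z) ≡ x ℤ.- z
    eq = solve-∀

  ≈-suc : ∀ {x y} → x ≈ y → ℤ.suc x ≈ ℤ.suc y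
  ≈-suc {x} {y} h = unsigned (eq x y) (signed h)
    where
    eq : ∀ x y → x ℤ.- y ≡ (1ℤ ℤ.+ x) ℤ.- (1ℤ ℤ.+ y)
    eq = solve-∀

  ≈-pred : ∀ {x y} → x ≈ y → ℤ.pred x ≈ ℤ.pred y
  ≈-pred {x} {y} h = unsigned (eq x y) (signed h)
    where
    eq : ∀ x y → x ℤ.- y ≡ (ℤ.-1ℤ ℤ.+ x) ℤ.- (ℤ.-1ℤ ℤ.+ y)
    eq = solve-∀

  suc≉ : 2 ≤ ℓ → ∀ {x y} → x ≈ y → ¬ ℤ.suc x ≈ y
  suc≉ 2≤ℓ {x} {y} h k with ∣1⇒≡1 (subst (λ d → ℤ.+ ℓ ℤ.∣ d) (eq x) (divisible (≈-trans k (≈-sym h))))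
    where
    eq : ∀ x → (1ℤ ℤ.+ x) ℤ.- x ≡ 1ℤ
    eq = solve-∀
  ... | refl = contradiction 2≤ℓ λ { (s≤s ()) }

  pred≉ : 2 ≤ ℓ → ∀ {x y} → x ≈ y → ¬ ℤ.pred x ≈ y
  pred≉ 2≤ℓ h k = suc≉ 2≤ℓ k (subst (_≈ _) (sym (ℤ.suc-pred _)) h)

  -- JM for a set of beads, hooks being the pairs of a bead and a smaller gap.
  MayaJM : (ℤ → Set) → Set
  MayaJM X = ∀ x y x′ y′ → X x → ¬ X y → X x′ → ¬ X y′ →
    y ℤ.< x → y ℤ.< x′ → y′ ℤ.< x → x ≈ y → ¬ x ≈ y′ → ¬ x′ ≈ y → ⊥

  -- Y arises from X by moving some beads of residue i into the gap just before.
  record Sorts (i : ℤ) (X Y : ℤ → Set) : Set where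
    field
      lost   : ∀ {z} → X z → ¬ Y z → z ≈ i × ¬ X (ℤ.pred z) × Y (ℤ.pred z)
      gained : ∀ {z} → ¬ X z → Y z → ℤ.suc z ≈ i × X (ℤ.suc z) × ¬ Y (ℤ.suc z)

  open Sorts

  Sorts-refl : ∀ {i X} → Sorts i X X
  Sorts-refl = record { lost = λ x ¬x → contradiction x ¬x ; gained = λ ¬x x → contradiction x ¬x }

  -- Extends a partial sorting by one move while `X` stays fixed. A moved bead lands on residue i -
  -- 1, which differs from i, so no bead moves twice and separate moves do not interfere.
  Sorts-move : 2 ≤ ℓ → ∀ {i X Y Z} → (∀ z → Dec (X z)) → (∀ z → Dec (Y z)) → Sorts i X Y → ∀ {c} → c ≈ i →
    Y c → ¬ Y (ℤ.pred c) → ¬ Z c → Z (ℤ.pred c) →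
    (∀ {z} → z ≢ c → z ≢ ℤ.pred c → Y z → Z z) → (∀ {z} → z ≢ c → z ≢ ℤ.pred c → Z z → Y z) →
    Sorts i X Z
  Sorts-move 2≤ℓ {i} {X} {Y} {Z} X? Y? s {c} c≈i Yc ¬Yc′ ¬Zc Zc′ Y⇒Z Z⇒Y = record { lost = lost′ ; gained = gained′ }
    where
    lost′ : ∀ {z} → X z → ¬ Z z → z ≈ i × ¬ X (ℤ.pred z) × Z (ℤ.pred z)
    lost′ {z} Xz ¬Zz with z ℤ.≟ c | z ℤ.≟ ℤ.pred c
    ... | _        | yes refl = contradiction Zc′ ¬Zz
    -- A bead of `X` at `pred c` would have left, since `Y` has none there; but only beads of
    -- residue i leave.
    ... | yes refl | _        = c≈i , (λ Xc′ → pred≉ 2≤ℓ c≈i (proj₁ (lost s Xc′ ¬Yc′))) , Zc′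
    ... | no z≢c   | no z≢c′  with lost s Xz (¬Zz ∘ Y⇒Z z≢c z≢c′)
    ...   | z≈i , ¬Xz′ , Yz′ =
      z≈i , ¬Xz′ , Y⇒Z (λ { refl → pred≉ 2≤ℓ z≈i c≈i }) (λ p → ¬Yc′ (subst Y p Yz′)) Yz′

    gained′ : ∀ {z} → ¬ X z → Z z → ℤ.suc z ≈ i × X (ℤ.suc z) × ¬ Z (ℤ.suc z)
    gained′ {z} ¬Xz Zz with z ℤ.≟ c | z ℤ.≟ ℤ.pred c
    ... | yes refl | _ = contradiction Zz ¬Zc
    ... | no z≢c | no z≢c′ with gained s ¬Xz (Z⇒Y z≢c z≢c′ Zz)
    ...   | sz≈i , Xsz , ¬Ysz = sz≈i , Xsz , λ Zsz →
      ¬Ysz (Z⇒Y (λ p → ¬Ysz (subst Y (sym p) Yc)) (λ p → pred≉ 2≤ℓ c≈i (subst (_≈ i) p sz≈i)) Zsz)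
    gained′ {z} ¬Xz Zz | no _ | yes refl rewrite ℤ.suc-pred c with X? c
    ... | yes Xc = c≈i , Xc , ¬Zc
    ... | no ¬Xc = contradiction (proj₁ (gained s ¬Xc Yc)) (suc≉ 2≤ℓ c≈i)

  module _ (2≤ℓ : 2 ≤ ℓ) {i : ℤ} {X Y : ℤ → Set} (X? : ∀ z → Dec (X z))
           (s : Sorts i X Y) (sorted : ∀ {z} → z ≈ i → Y z → Y (ℤ.pred z)) where

    -- `sorted` puts a bead at `pred z` in `Y`. Had it arrived by a move, it would have come from
    -- `z` and left `z` empty; so both beads are already in `X`.
    bead-i : ∀ {z} → z ≈ i → Y z → X z × X (ℤ.pred z)
    bead-i {z} z≈i Yz with X? z | X? (ℤ.pred z)
    ... | no ¬Xz | _       = contradiction (proj₁ (gained s ¬Xz Yz)) (suc≉ 2≤ℓ z≈i)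
    ... | yes Xz | yes Xz′ = Xz , Xz′
    ... | yes Xz | no ¬Xz′ = contradiction (subst Y (sym (ℤ.suc-pred z)) Yz) (proj₂ (proj₂ (gained s ¬Xz′ (sorted z≈i Yz))))

    -- The mirror image of `bead-i`, with gaps for beads and the line reversed.
    gap-pred-i : ∀ {z} → ℤ.suc z ≈ i → ¬ Y z → ¬ X z × ¬ X (ℤ.suc z)
    gap-pred-i {z} sz≈i ¬Yz =
      (λ Xz → suc≉ 2≤ℓ (proj₁ (lost s Xz ¬Yz)) sz≈i) ,
      (λ Xsz → contradiction (subst Y (ℤ.pred-suc z) (proj₂ (proj₂ (lost s Xsz ¬Ysz)))) ¬Yz)
      where
      ¬Ysz : ¬ Y (ℤ.suc z)
      ¬Ysz Ysz = ¬Yz (subst Y (ℤ.pred-suc z) (sorted sz≈i Ysz))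

    -- A forbidden configuration in `Y` is traced back to one in `X`. The cases are: the corner bead
    -- `x`, and with it `y`, has residue i, residue i - 1, or neither.
    MayaJM-sort : MayaJM X → MayaJM Y
    MayaJM-sort jm x y x′ y′ Yx ¬Yy Yx′ ¬Yy′ y<x y<x′ y′<x x≈y x≉y′ x′≉y with x ≈? i | ℤ.suc x ≈? i
    ... | yes x≈i | _ = case-i (X? y)
      where
      Xx  = proj₁ (bead-i x≈i Yx)
      Xx⁻ = proj₂ (bead-i x≈i Yx)
      case-i : Dec (X y) → ⊥
      case-i (no ¬Xy) with X? y′
      ... | yes Xy′ = x≉y′ (≈-trans x≈i (≈-sym (proj₁ (lost s Xy′ ¬Yy′))))
      -- The bead at `x′` may have moved, but `pred x` serves in its place: it is in `X` and
      -- incongruent to `y`.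
      ... | no ¬Xy′ = jm x y (ℤ.pred x) y′ Xx ¬Xy Xx⁻ ¬Xy′ y<x
                        (ℤ.≤∧≢⇒< (ℤ.i<j⇒i≤pred[j] y<x) λ { refl → ¬Xy Xx⁻ }) y′<x x≈y x≉y′ (pred≉ 2≤ℓ x≈y)
      -- The bead at `y` moved to `pred y`, a gap of `X`. So the corner shifts down by one and `y`
      -- becomes the column bead. The row gap stays `y′` unless `suc y′` has residue i; then `y′` is
      -- congruent to `pred x`, and `suc y′`, also a gap of `X`, replaces it.
      case-i (yes Xy) with lost s Xy ¬Yy
      ... | _ , ¬Xy⁻ , _ with ℤ.suc y′ ≈? i
      ...   | yes sy′≈i = jm (ℤ.pred x) (ℤ.pred y) y (ℤ.suc y′) Xx⁻ ¬Xy⁻ Xy ¬Xsy′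
                (ℤ.+-monoʳ-< ℤ.-1ℤ y<x) (ℤ.i≤pred[j]⇒i<j ℤ.≤-refl)
                (ℤ.≤∧≢⇒< (ℤ.i<j⇒suc[i]≤j y′<x⁻) λ eq → ¬Xsy′ (subst X (sym eq) Xx⁻))
                (≈-pred x≈y)
                (λ h → pred≉ 2≤ℓ x≈i (≈-trans h sy′≈i))
                (pred≉ 2≤ℓ ≈-refl ∘ ≈-sym)
              where
              ¬Xy′ = proj₁ (gap-pred-i sy′≈i ¬Yy′)
              ¬Xsy′ = proj₂ (gap-pred-i sy′≈i ¬Yy′)
              y′<x⁻ : y′ ℤ.< ℤ.pred x
              y′<x⁻ = ℤ.≤∧≢⇒< (ℤ.i<j⇒i≤pred[j] y′<x) λ { refl → ¬Xy′ Xx⁻ }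
      ...   | no sy′≉i with X? y′
      ...     | yes Xy′ = x≉y′ (≈-trans x≈i (≈-sym (proj₁ (lost s Xy′ ¬Yy′))))
      ...     | no ¬Xy′ = jm (ℤ.pred x) (ℤ.pred y) y y′ Xx⁻ ¬Xy⁻ Xy ¬Xy′
                (ℤ.+-monoʳ-< ℤ.-1ℤ y<x) (ℤ.i≤pred[j]⇒i<j ℤ.≤-refl)
                (ℤ.≤∧≢⇒< (ℤ.i<j⇒i≤pred[j] y′<x) λ { refl → ¬Xy′ Xx⁻ })
                (≈-pred x≈y)
                (λ h → sy′≉i (≈-trans (≈-sym (subst (_≈ ℤ.suc y′) (ℤ.suc-pred x) (≈-suc h))) x≈i))
                (pred≉ 2≤ℓ ≈-refl ∘ ≈-sym)
    -- The mirror image of the previous case: now the gap `y` is the one certain to be unmoved, and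
    -- a bead gained at `x` shifts the corner up by one.
    MayaJM-sort jm x y x′ y′ Yx ¬Yy Yx′ ¬Yy′ y<x y<x′ y′<x x≈y x≉y′ x′≉y | no _ | yes sx≈i = case-i⁻ (X? x)
      where
      sy≈i : ℤ.suc y ≈ i
      sy≈i = ≈-trans (≈-sym (≈-suc x≈y)) sx≈i
      ¬Xy  = proj₁ (gap-pred-i sy≈i ¬Yy)
      ¬Xsy = proj₂ (gap-pred-i sy≈i ¬Yy)
      gained⇒≈y : ∀ {z} → ℤ.suc z ≈ i → z ≈ y
      gained⇒≈y sz≈i = subst₂ _≈_ (ℤ.pred-suc _) (ℤ.pred-suc _)
        (≈-pred (≈-trans sz≈i (≈-sym sy≈i)))
      case-i⁻ : Dec (X x) → ⊥
      case-i⁻ (yes Xx) with X? x′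
      ... | no ¬Xx′ = x′≉y (gained⇒≈y (proj₁ (gained s ¬Xx′ Yx′)))
      ... | yes Xx′ = jm x y x′ (ℤ.suc y) Xx ¬Xy Xx′ ¬Xsy y<x y<x′
                        (ℤ.≤∧≢⇒< (ℤ.i<j⇒suc[i]≤j y<x) λ { refl → ¬Xsy Xx })
                        x≈y (λ h → suc≉ 2≤ℓ (≈-sym x≈y) (≈-sym h)) x′≉y
      case-i⁻ (no ¬Xx) with gained s ¬Xx Yx
      ... | _ , Xsx , _ with x′ ≈? i
      ...   | yes x′≈i = jm (ℤ.suc x) (ℤ.suc y) (ℤ.pred x′) x Xsx ¬Xsy Xx′⁻ ¬Xx
                (ℤ.+-monoʳ-< 1ℤ y<x)
                (ℤ.≤∧≢⇒< (ℤ.i<j⇒i≤pred[j] sy<x′) λ eq → ¬Xsy (subst X (sym eq) Xx′⁻))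
                (ℤ.suc[i]≤j⇒i<j ℤ.≤-refl)
                (≈-suc x≈y)
                (suc≉ 2≤ℓ ≈-refl)
                (λ h → pred≉ 2≤ℓ x′≈i (≈-trans h sy≈i))
              where
              Xx′ = proj₁ (bead-i x′≈i Yx′)
              Xx′⁻ = proj₂ (bead-i x′≈i Yx′)
              sy<x′ : ℤ.suc y ℤ.< x′
              sy<x′ = ℤ.≤∧≢⇒< (ℤ.i<j⇒suc[i]≤j y<x′) λ { refl → ¬Xsy Xx′ }
      ...   | no x′≉i with X? x′
      ...     | no ¬Xx′ = x′≉y (gained⇒≈y (proj₁ (gained s ¬Xx′ Yx′)))
      ...     | yes Xx′ = jm (ℤ.suc x) (ℤ.suc y) x′ x Xsx ¬Xsy Xx′ ¬Xx
                (ℤ.+-monoʳ-< 1ℤ y<x)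
                (ℤ.≤∧≢⇒< (ℤ.i<j⇒suc[i]≤j y<x′) λ { refl → ¬Xsy Xx′ })
                (ℤ.suc[i]≤j⇒i<j ℤ.≤-refl)
                (≈-suc x≈y)
                (suc≉ 2≤ℓ ≈-refl)
                (λ h → x′≉i (≈-trans h sy≈i))
    MayaJM-sort jm x y x′ y′ Yx ¬Yy Yx′ ¬Yy′ y<x y<x′ y′<x x≈y x≉y′ x′≉y | no x≉i | no sx≉i =
      jm x y x″ y″ Xx ¬Xy Xx″ ¬Xy″ y<x y<x″ y″<x x≈y x≉y″ x″≉y
      where
      Xx : X x
      Xx with X? x
      ... | yes h = h
      ... | no ¬h = contradiction (proj₁ (gained s ¬h Yx)) sx≉i
      ¬Xy : ¬ X y
      ¬Xy h = x≉i (≈-trans x≈y (proj₁ (lost s h ¬Yy)))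
      -- A gap vacated at `y′` has a gap of `X` just before it. That one is incongruent to `x`,
      -- since otherwise `suc x` would have residue i. `bead` is dual.
      gap : ∃[ y″ ] (¬ X y″ × y″ ℤ.< x × ¬ x ≈ y″)
      gap with X? y′
      ... | no ¬h = y′ , ¬h , y′<x , x≉y′
      ... | yes h with y′≈i , ¬h⁻ , _ ← lost s h ¬Yy′ =
        ℤ.pred y′ , ¬h⁻ , ℤ.≤-<-trans (ℤ.i≤j⇒pred[i]≤j ℤ.≤-refl) y′<x ,
        λ k → sx≉i (≈-trans (subst (ℤ.suc x ≈_) (ℤ.suc-pred y′) (≈-suc k)) y′≈i)
      bead : ∃[ x″ ] (X x″ × y ℤ.< x″ × ¬ x″ ≈ y)
      bead with X? x′
      ... | yes h = x′ , h , y<x′ , x′≉y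
      ... | no ¬h with sx′≈i , h⁺ , _ ← gained s ¬h Yx′ =
        ℤ.suc x′ , h⁺ , ℤ.<-≤-trans y<x′ (ℤ.i≤suc[i] x′) ,
        λ k → x≉i (≈-trans x≈y (≈-trans (≈-sym k) sx′≈i))
      y″ = proj₁ gap
      x″ = proj₁ bead
      ¬Xy″ = proj₁ (proj₂ gap)
      y″<x = proj₁ (proj₂ (proj₂ gap))
      x≉y″ = proj₂ (proj₂ (proj₂ gap))
      Xx″ = proj₁ (proj₂ bead)
      y<x″ = proj₁ (proj₂ (proj₂ bead))
      x″≉y = proj₂ (proj₂ (proj₂ bead))

-- The Maya diagram of a partition.

-- The vertical and horizontal steps of the boundary of the diagram, indexed by rows and columns.
-- Together they occupy every integer once.
bead gap : Partition → ℕ → ℤ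
bead μ a = ℤ.+ row μ a ℤ.- ℤ.+ suc a
gap  μ b = ℤ.+ b ℤ.- ℤ.+ col μ b

Beads : Partition → ℤ → Set
Beads μ z = ∃[ a ] bead μ a ≡ z

bead-antitone : ∀ μ {a c} → a < c → bead μ c ℤ.< bead μ a
bead-antitone μ a<c = ℤ.+-mono-≤-< (+≤+ (row-antitone μ (<⇒≤ a<c))) (ℤ.neg-mono-< (+<+ (s≤s a<c)))

bead-injective : ∀ μ {a c} → bead μ a ≡ bead μ c → a ≡ c
bead-injective μ {a} {c} eq with <-cmp a c
... | tri< a<c _ _ = contradiction (bead-antitone μ a<c) (ℤ.<-irrefl (sym eq))
... | tri≈ _ a≡c _ = a≡c
... | tri> _ _ c<a = contradiction (bead-antitone μ c<a) (ℤ.<-irrefl eq)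

∈ᴰ⇒gap<bead : ∀ μ {a b} → b < row μ a → gap μ b ℤ.< bead μ a
∈ᴰ⇒gap<bead μ h = ℤ.+-mono-<-≤ (+<+ h) (ℤ.neg-mono-≤ (+≤+ (∈ᴰ⇒<col μ h)))

∉ᴰ⇒bead<gap : ∀ μ {a b} → row μ a ≤ b → bead μ a ℤ.< gap μ b
∉ᴰ⇒bead<gap μ h = ℤ.+-mono-≤-< (+≤+ h) (ℤ.neg-mono-< (+<+ (s≤s (row≤⇒col≤ μ h))))

gap<bead⇒∈ᴰ : ∀ μ {a b} → gap μ b ℤ.< bead μ a → b < row μ a
gap<bead⇒∈ᴰ μ h = ≰⇒> λ r≤b → ℤ.<-asym h (∉ᴰ⇒bead<gap μ r≤b)

gap∉Beads : ∀ μ b → ¬ Beads μ (gap μ b)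
gap∉Beads μ b (a , eq) with b <? row μ a
... | yes h = ℤ.<-irrefl (sym eq) (∈ᴰ⇒gap<bead μ h)
... | no h  = ℤ.<-irrefl eq (∉ᴰ⇒bead<gap μ (≮⇒≥ h))

hook≡bead-gap : ∀ μ {a b} → b < row μ a → ℤ.+ hook μ a b ≡ bead μ a ℤ.- gap μ b
hook≡bead-gap μ {a} {b} h = begin
  ℤ.+ hook μ a b                                     ≡⟨ add-sub (ℤ.+ hook μ a b) (ℤ.+ a) (ℤ.+ b) ⟩
  ℤ.+ (hook μ a b + (a + suc b)) ℤ.- ℤ.+ (a + suc b) ≡⟨ cong (λ n → ℤ.+ n ℤ.- ℤ.+ (a + suc b)) (hook-formula μ h) ⟩
  ℤ.+ (row μ a + col μ b) ℤ.- ℤ.+ (a + suc b)        ≡⟨ regroup (ℤ.+ row μ a) (ℤ.+ col μ b) (ℤ.+ a) (ℤ.+ b) ⟩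
  bead μ a ℤ.- gap μ b                               ∎
  where
  open ≡-Reasoning
  add-sub : ∀ h a b → h ≡ (h ℤ.+ (a ℤ.+ (1ℤ ℤ.+ b))) ℤ.- (a ℤ.+ (1ℤ ℤ.+ b))
  add-sub = solve-∀
  regroup : ∀ r c a b → (r ℤ.+ c) ℤ.- (a ℤ.+ (1ℤ ℤ.+ b)) ≡ (r ℤ.- (1ℤ ℤ.+ a)) ℤ.- (b ℤ.- c)
  regroup = solve-∀

gap-between : ∀ μ n {z} → bead μ n ℤ.< z → (∀ {x} → suc x ≡ n → z ℤ.< bead μ x) → ∃[ b ] gap μ b ≡ z
gap-between μ n {z} below above with z ℤ.+ ℤ.+ n in eq | row≤
  where
  suc-bead : ∀ r n → (1ℤ ℤ.+ (r ℤ.- (1ℤ ℤ.+ n))) ℤ.+ n ≡ r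
  suc-bead = solve-∀
  row≤ : ℤ.+ row μ n ℤ.≤ z ℤ.+ ℤ.+ n
  row≤ = subst (ℤ._≤ z ℤ.+ ℤ.+ n) (suc-bead (ℤ.+ row μ n) (ℤ.+ n)) (ℤ.+-monoˡ-≤ (ℤ.+ n) (ℤ.i<j⇒suc[i]≤j below))
-- A row length bounds `z + n` from below, so it is a natural number `b`. Row `n` ends by column `b`
-- and row `n - 1` passes it, so that column has length `n`.
... | ℤ.+ b | +≤+ r≤b = b , (begin
    ℤ.+ b ℤ.- ℤ.+ col μ b       ≡⟨ cong₂ (λ w c → w ℤ.- ℤ.+ c) (sym eq) (≤-antisym (row≤⇒col≤ μ r≤b) (n≤col n above eq)) ⟩
    (z ℤ.+ ℤ.+ n) ℤ.- ℤ.+ n     ≡⟨ add-sub z (ℤ.+ n) ⟩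
    z                           ∎)
  where
  open ≡-Reasoning
  add-sub : ∀ z n → (z ℤ.+ n) ℤ.- n ≡ z
  add-sub = solve-∀
  bead+ : ∀ r n → (r ℤ.- n) ℤ.+ n ≡ r
  bead+ = solve-∀
  n≤col : ∀ n → (∀ {x} → suc x ≡ n → z ℤ.< bead μ x) → z ℤ.+ ℤ.+ n ≡ ℤ.+ b → n ≤ col μ b
  n≤col zero    _     _ = z≤n
  n≤col (suc x) above eq = ∈ᴰ⇒<col μ (ℤ.drop‿+<+ (subst₂ ℤ._<_ eq (bead+ (ℤ.+ row μ x) (ℤ.+ suc x))
                              (ℤ.+-monoˡ-< (ℤ.+ suc x) (above refl))))

bead⊎gap : ∀ μ z → Beads μ z ⊎ (∃[ b ] gap μ b ≡ z)
bead⊎gap μ z = search far far≤z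
  where
  search : ∀ n → bead μ n ℤ.≤ z → Beads μ z ⊎ (∃[ b ] gap μ b ≡ z)
  search n n≤z with bead μ n ℤ.≟ z
  search n n≤z       | yes eq = inj₁ (n , eq)
  search zero n≤z    | no neq = inj₂ (gap-between μ 0 (ℤ.≤∧≢⇒< n≤z neq) λ ())
  search (suc n) n≤z | no neq with bead μ n ℤ.≤? z
  ... | yes h = search n h
  ... | no h  = inj₂ (gap-between μ (suc n) (ℤ.≤∧≢⇒< n≤z neq) λ { refl → ℤ.≰⇒> h })

  -- Beyond the last part row `n` has bead - n - 1, which is below - ∣z∣ for this `n`.
  far = length (parts μ) + ℤ.∣ z ∣

  -∣z∣≤z : ∀ z → ℤ.- (ℤ.+ ℤ.∣ z ∣) ℤ.≤ z
  -∣z∣≤z (ℤ.+ n)    = ℤ.neg-≤-pos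
  -∣z∣≤z ℤ.-[1+ n ] = ℤ.≤-refl

  far≤z : bead μ far ℤ.≤ z
  far≤z = begin
    ℤ.+ row μ far ℤ.- ℤ.+ suc far ≡⟨ cong (λ r → ℤ.+ r ℤ.- ℤ.+ suc far) (nth-beyond (parts μ) (m≤m+n _ ℤ.∣ z ∣)) ⟩
    ℤ.- (ℤ.+ suc far)              ≤⟨ ℤ.neg-mono-≤ (+≤+ (m≤n⇒m≤1+n (m≤n+m ℤ.∣ z ∣ _))) ⟩
    ℤ.- (ℤ.+ ℤ.∣ z ∣)              ≤⟨ -∣z∣≤z z ⟩
    z                              ∎
    where open ℤ.≤-Reasoning

bead? : ∀ μ z → Dec (Beads μ z)
bead? μ z with bead⊎gap μ z
... | inj₁ h          = yes h
... | inj₂ (b , refl) = no (gap∉Beads μ b)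

content : Position → ℤ
content (a , b) = ℤ.+ b ℤ.- ℤ.+ a

suc-minus-suc : ∀ b a → ℤ.+ suc b ℤ.- ℤ.+ suc a ≡ ℤ.+ b ℤ.- ℤ.+ a
suc-minus-suc b a = go (ℤ.+ b) (ℤ.+ a)
  where
  go : ∀ b a → (1ℤ ℤ.+ b) ℤ.- (1ℤ ℤ.+ a) ≡ b ℤ.- a
  go = solve-∀

minus-suc : ∀ b a → ℤ.+ b ℤ.- ℤ.+ suc a ≡ ℤ.pred (ℤ.+ b ℤ.- ℤ.+ a)
minus-suc b a = go (ℤ.+ b) (ℤ.+ a)
  where
  go : ∀ b a → b ℤ.- (1ℤ ℤ.+ a) ≡ ℤ.-1ℤ ℤ.+ (b ℤ.- a)
  go = solve-∀

bead-removable : ∀ μ {p} → RemovableSite μ p → bead μ (proj₁ p) ≡ content p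
bead-removable μ {a , b} (end , _) = trans (cong (λ r → ℤ.+ r ℤ.- ℤ.+ suc a) end) (suc-minus-suc b a)

bead-addable : ∀ μ {p} → AddableSite μ p → bead μ (proj₁ p) ≡ ℤ.pred (content p)
bead-addable μ {a , b} (end , _) = trans (cong (λ r → ℤ.+ r ℤ.- ℤ.+ suc a) end) (minus-suc b a)

module _ (ℓ : ℕ) where
  open Congruence ℓ

  ∣hook⇒≈ : ∀ μ {a b} → b < row μ a → ℤ.+ ℓ ℤ.∣ ℤ.+ hook μ a b → bead μ a ≈ gap μ b
  ∣hook⇒≈ μ h = mk≈ ∘ subst (ℤ.+ ℓ ℤ.∣_) (hook≡bead-gap μ h)

  ≈⇒∣hook : ∀ μ {a b} → b < row μ a → bead μ a ≈ gap μ b → ℤ.+ ℓ ℤ.∣ ℤ.+ hook μ a b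
  ≈⇒∣hook μ h = subst (ℤ.+ ℓ ℤ.∣_) (sym (hook≡bead-gap μ h)) ∘ divisible

  IsJM⇒MayaJM : ∀ μ → IsJM ℓ μ → MayaJM (Beads μ)
  IsJM⇒MayaJM μ jm _ y _ y′ (a , refl) ¬y (c , refl) ¬y′ y<x y<x′ y′<x x≈y x≉y′ x′≉y
    with bead⊎gap μ y | bead⊎gap μ y′
  ... | inj₁ h          | _ = ¬y h
  ... | _               | inj₁ h = ¬y′ h
  ... | inj₂ (b , refl) | inj₂ (d , refl) =
    jm (a , b , c , d , ab , ad , cb , ≈⇒∣hook μ ab x≈y , x≉y′ ∘ ∣hook⇒≈ μ ad , x′≉y ∘ ∣hook⇒≈ μ cb)
    where
    ab = gap<bead⇒∈ᴰ μ y<x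
    ad = gap<bead⇒∈ᴰ μ y′<x
    cb = gap<bead⇒∈ᴰ μ y<x′

  MayaJM⇒IsJM : ∀ μ → MayaJM (Beads μ) → IsJM ℓ μ
  MayaJM⇒IsJM μ jm (a , b , c , d , ab , ad , cb , h , k , l) =
    jm _ _ _ _ (a , refl) (gap∉Beads μ b) (c , refl) (gap∉Beads μ d)
       (∈ᴰ⇒gap<bead μ ab) (∈ᴰ⇒gap<bead μ cb) (∈ᴰ⇒gap<bead μ ad)
       (∣hook⇒≈ μ ab h) (k ∘ ≈⇒∣hook μ ad) (l ∘ ≈⇒∣hook μ cb)

  Sorts-remove : 2 ≤ ℓ → ∀ {i X μ ν p} → (∀ z → Dec (X z)) → AddsBox μ p ν → content p ≈ i →
    Sorts i X (Beads ν) → Sorts i X (Beads μ)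
  Sorts-remove 2≤ℓ {i} {X} {μ} {ν} {a , b} X? adds p≈i s =
    Sorts-move 2≤ℓ X? (bead? ν) s p≈i (a , νa) ¬ν ¬μ (a , μa)
      (λ { z≢ _ (x , refl) → x , cong (λ r → ℤ.+ r ℤ.- ℤ.+ suc x) (sym (other (λ { refl → z≢ νa }))) })
      (λ { _ z≢ (x , refl) → x , cong (λ r → ℤ.+ r ℤ.- ℤ.+ suc x) (other (λ { refl → z≢ μa })) })
    where
    other : ∀ {x} → x ≢ a → row ν x ≡ row μ x
    other = other-rows {μ} {ν} adds _
    νa = bead-removable ν (removableSite {μ} {ν} adds)
    μa = bead-addable μ (addableSite {μ} {ν} adds)
    pred≢ : ∀ c → c ≢ ℤ.pred c
    pred≢ c eq = ℤ.<-irrefl (sym eq) (ℤ.i≤pred[j]⇒i<j ℤ.≤-refl)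
    ¬ν : ¬ Beads ν (ℤ.pred (content (a , b)))
    ¬ν (x , eq) with x ≟ a
    ... | yes refl = pred≢ _ (trans (sym νa) eq)
    ... | no x≢a   = x≢a (bead-injective μ (trans (cong (λ r → ℤ.+ r ℤ.- ℤ.+ suc x) (sym (other x≢a))) (trans eq (sym μa))))
    ¬μ : ¬ Beads μ (content (a , b))
    ¬μ (x , eq) with x ≟ a
    ... | yes refl = pred≢ _ (trans (sym eq) μa)
    ... | no x≢a   = x≢a (bead-injective ν (trans (cong (λ r → ℤ.+ r ℤ.- ℤ.+ suc x) (other x≢a)) (trans eq (sym νa))))

  -- A bead with a gap just before it belongs to a row longer than the next one; the last box of
  -- that row is removable and its content is the bead.
  no-removable⇒sorted : ∀ μ {i} → (∀ p → content p ≈ i → ¬ Removable μ p) →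
    ∀ {z} → z ≈ i → Beads μ z → Beads μ (ℤ.pred z)
  no-removable⇒sorted μ {i} none z≈i (a , refl) with row μ (suc a) <? row μ a
  ... | no h = suc a , (begin
      ℤ.+ row μ (suc a) ℤ.- ℤ.+ suc (suc a) ≡⟨ cong (λ r → ℤ.+ r ℤ.- ℤ.+ suc (suc a)) (≤-antisym (row-antitone μ (n≤1+n a)) (≮⇒≥ h)) ⟩
      ℤ.+ row μ a ℤ.- ℤ.+ suc (suc a)       ≡⟨ minus-suc (row μ a) (suc a) ⟩
      ℤ.pred (bead μ a)                      ∎)
    where open ≡-Reasoning
  ... | yes h with row μ a in eq | h
  ...   | suc b | s≤s below = contradiction (RemovableSite⇒Removable μ (eq , below))
          (none (a , b) (subst (_≈ i) (suc-minus-suc b a) z≈i))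

-- Separation of addable and removable boxes by ladders.

col-antitone-suc : ∀ μ b → col μ (suc b) ≤ col μ b
col-antitone-suc μ b = row≤⇒col≤ μ (m≤n⇒m≤1+n (≮⇒≥ (<-irrefl refl ∘ ∈ᴰ⇒<col μ)))

hook-positive : ∀ μ a b → 0 < hook μ a b
hook-positive μ a b = m≤n+m 1 (arm μ a b + leg μ a b)

hook-below : ∀ μ {a b} → b < row μ (suc a) → hook μ (suc a) b < hook μ a b
hook-below μ {a} {b} h = +-cancelʳ-< (a + suc b) _ _ (begin
  suc (hook μ (suc a) b + (a + suc b)) ≡⟨ +-suc _ _ ⟨
  hook μ (suc a) b + (suc a + suc b)   ≡⟨ hook-formula μ h ⟩
  row μ (suc a) + col μ b              ≤⟨ +-monoˡ-≤ _ row≤ ⟩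
  row μ a + col μ b                    ≡⟨ hook-formula μ (<-≤-trans h row≤) ⟨
  hook μ a b + (a + suc b)             ∎)
  where
  open ≤-Reasoning
  row≤ = row-antitone μ (n≤1+n a)

hook-right : ∀ μ {a b} → suc b < row μ a → hook μ a (suc b) < hook μ a b
hook-right μ {a} {b} h = +-cancelʳ-< (a + suc b) _ _ (begin
  suc (hook μ a (suc b) + (a + suc b)) ≡⟨ +-suc _ _ ⟨
  hook μ a (suc b) + suc (a + suc b)   ≡⟨ cong (hook μ a (suc b) +_) (+-suc a (suc b)) ⟨
  hook μ a (suc b) + (a + suc (suc b)) ≡⟨ hook-formula μ h ⟩
  row μ a + col μ (suc b)              ≤⟨ +-monoʳ-≤ (row μ a) (col-antitone-suc μ b) ⟩
  row μ a + col μ b                    ≡⟨ hook-formula μ (<-trans (n<1+n b) h) ⟨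
  hook μ a b + (a + suc b)             ∎)
  where open ≤-Reasoning

-- Successive multiples differ by at least ℓ, and the last one, being positive, is itself at least
-- ℓ.
decreasing-multiples : ∀ {ℓ} n (f : ℕ → ℕ) → (∀ k → k < n → ℓ ∣ f k) → (∀ k → 0 < f k) →
  (∀ k → suc k < n → f (suc k) < f k) → n * ℓ ≤ f 0
decreasing-multiples zero f _ _ _ = z≤n
decreasing-multiples {ℓ} (suc n) f div pos dec with div 0 z<s
... | divides q eq = subst (suc n * ℓ ≤_) (sym eq) (*-monoˡ-≤ ℓ (*-cancelʳ-< ℓ n q (subst (n * ℓ <_) eq (below n dec rest))))
  where
  rest = decreasing-multiples n (f ∘ suc) (λ k → div (suc k) ∘ s<s) (pos ∘ suc) (λ k → dec (suc k) ∘ s<s)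
  below : ∀ n → (∀ k → suc k < suc n → f (suc k) < f k) → n * ℓ ≤ f 1 → n * ℓ < f 0
  below zero    _   _    = pos 0
  below (suc n) dec n*ℓ≤ = ≤-<-trans n*ℓ≤ (dec 0 (s<s z<s))

col-addable : ∀ μ {c d} → AddableSite μ (c , d) → col μ d ≡ c
col-addable μ {c} (end , above) = ≤-antisym (row≤⇒col≤ μ (≤-reflexive end)) (c≤ c above)
  where
  c≤ : ∀ c → (∀ {x} → x < c → _ < row μ x) → c ≤ col μ _
  c≤ zero    _     = z≤n
  c≤ (suc c) above = ∈ᴰ⇒<col μ (above ≤-refl)

module _ μ {a b} (rem : RemovableSite μ (a , b)) where

  removable∈ : b < row μ a
  removable∈ = ≤-reflexive (sym (proj₁ rem))

  col-removable : col μ b ≡ suc a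
  col-removable = ≤-antisym (row≤⇒col≤ μ (proj₂ rem)) (∈ᴰ⇒<col μ removable∈)

  hook-removable : hook μ a b ≡ 1
  hook-removable = +-cancelʳ-≡ (a + suc b) _ _ (trans (hook-formula μ removable∈)
    (trans (cong₂ _+_ (proj₁ rem) col-removable) (trans (+-suc (suc b) a) (cong suc (+-comm (suc b) a)))))

module _ {m : ℕ} (2≤m : 2 ≤ m) where

  ℓ : ℕ
  ℓ = suc m

  open Congruence ℓ

  ∤hook-removable : ∀ μ {a b} → RemovableSite μ (a , b) → ℓ ∤ hook μ a b
  ∤hook-removable μ rem h with ∣1⇒≡1 (subst (ℓ ∣_) (hook-removable μ rem) h)
  ... | refl = contradiction 2≤m λ ()

  -- If an addable and a removable box have the same residue, then the hook at
  -- the corner of the rectangle they span is divisible by ℓ, while the hook of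
  -- the removable box is 1.  The JM condition makes the whole side from the
  -- corner towards the addable box divisible by ℓ, so the partition is steep
  -- there, which separates the ladders.
  addable-precedes-removable : ∀ μ {p q} → IsJM ℓ μ → AddableSite μ p → RemovableSite μ q →
    content p ≈ content q → Precedes ℓ p q
  addable-precedes-removable μ {c , d} {a , b} jm add rem p≈q with a <? c
  -- The addable box is the lower one: the corner is `(a , d)`, and the `k` hooks below it in column
  -- `d`, its own included, are multiples of ℓ.
  ... | yes a<c with k , refl ← m≤n⇒∃[o]m+o≡n (<⇒≤ a<c) = inj₁ (begin-strict
      a + k + m * d          ≡⟨ +-assoc a k (m * d) ⟩
      a + (k + m * d)        <⟨ +-monoʳ-< a (+-monoˡ-< (m * d) k<) ⟩
      a + (m * (k * m) + m * d) ≡⟨ cong (a +_) (*-distribˡ-+ m (k * m) d) ⟨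
      a + m * (k * m + d)    ≤⟨ +-monoʳ-≤ a (*-monoʳ-≤ m steep) ⟩
      a + m * b              ∎)
    where
    open ≤-Reasoning
    in-col : ∀ x → x < k → d < row μ (a + x)
    in-col x x<k = proj₂ add (+-monoʳ-< a x<k)
    corner : d < row μ a
    corner = proj₂ add a<c
    ∣corner : ℓ ∣ hook μ a d
    ∣corner = ≈⇒∣hook ℓ μ corner (subst₂ _≈_ (sym (bead-removable μ rem))
      (cong (λ n → ℤ.+ d ℤ.- ℤ.+ n) (sym (col-addable μ add))) (≈-sym p≈q))
    ∣col : ∀ x → x < k → ℓ ∣ hook μ (a + x) d
    ∣col x x<k = decidable-stable (ℓ ∣? hook μ (a + x) d) λ ∤ →
      jm (a , d , a + x , b , corner , removable∈ μ rem , in-col x x<k , ∣corner , ∤hook-removable μ rem , ∤)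
    tall : k * ℓ ≤ hook μ a d
    tall = subst (λ x → k * ℓ ≤ hook μ x d) (+-identityʳ a)
      (decreasing-multiples k (λ x → hook μ (a + x) d) ∣col (λ x → hook-positive μ (a + x) d)
        (λ x sx<k → subst (λ y → hook μ y d < hook μ (a + x) d) (sym (+-suc a x))
          (hook-below μ (subst (λ y → d < row μ y) (+-suc a x) (in-col (suc x) sx<k)))))
    steep : k * m + d ≤ b
    steep = +-cancelʳ-≤ (k + suc a) _ _ (begin
      k * m + d + (k + suc a)  ≡⟨ solve 4 (λ k m d a → k :* m :+ d :+ (k :+ (con 1 :+ a)) := k :* (con 1 :+ m) :+ (a :+ (con 1 :+ d))) refl k m d a ⟩
      k * ℓ + (a + suc d)      ≤⟨ +-monoˡ-≤ _ tall ⟩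
      hook μ a d + (a + suc d) ≡⟨ hook-formula μ corner ⟩
      row μ a + col μ d        ≡⟨ cong₂ _+_ (proj₁ rem) (col-addable μ add) ⟩
      suc b + (a + k)          ≡⟨ solve 3 (λ b a k → con 1 :+ b :+ (a :+ k) := b :+ (k :+ (con 1 :+ a))) refl b a k ⟩
      b + (k + suc a)          ∎)
      where open +-*-Solver
    0<k : 0 < k
    0<k = +-cancelˡ-< a 0 k (subst (_< a + k) (sym (+-identityʳ a)) a<c)
    -- Here ℓ ≥ 3 enters. For m = 1 the two sides agree, and both boxes could share a ladder with
    -- the removable one on top.
    k< : k < m * (k * m)
    k< = <-≤-trans (m<m*n k m {{>-nonZero 0<k}} 2≤m) (m≤n*m (k * m) m {{>-nonZero (<-trans z<s 2≤m)}})
  -- Transposed situation: the corner is `(c , b)` and the `k` hooks run along row `c`.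
  ... | no a≮c with c≤a ← ≮⇒≥ a≮c
               with b<d ← ≤-trans (removable∈ μ rem) (subst (row μ a ≤_) (proj₁ add) (row-antitone μ c≤a))
               with k , refl ← m≤n⇒∃[o]m+o≡n (<⇒≤ b<d) = same-or-later
    where
    open ≤-Reasoning
    in-row : ∀ y → y < k → b + y < row μ c
    in-row y y<k = subst (b + y <_) (sym (proj₁ add)) (+-monoʳ-< b y<k)
    corner : b < row μ c
    corner = subst (b <_) (sym (proj₁ add)) b<d
    ∣corner : ℓ ∣ hook μ c b
    ∣corner = ≈⇒∣hook ℓ μ corner (subst₂ _≈_ (sym (bead-addable μ add))
      (trans (sym (minus-suc b a)) (cong (λ n → ℤ.+ b ℤ.- ℤ.+ n) (sym (col-removable μ rem)))) (≈-pred p≈q))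
    ∣row : ∀ y → y < k → ℓ ∣ hook μ c (b + y)
    ∣row y y<k = decidable-stable (ℓ ∣? hook μ c (b + y)) λ ∤ →
      jm (c , b , a , b + y , corner , in-row y y<k , removable∈ μ rem , ∣corner , ∤ , ∤hook-removable μ rem)
    wide : k * ℓ ≤ hook μ c b
    wide = subst (λ y → k * ℓ ≤ hook μ c y) (+-identityʳ b)
      (decreasing-multiples k (λ y → hook μ c (b + y)) ∣row (λ y → hook-positive μ c (b + y))
        (λ y sy<k → subst (λ x → hook μ c x < hook μ c (b + y)) (sym (+-suc b y))
          (hook-right μ (subst (_< row μ c) (+-suc b y) (in-row (suc y) sy<k)))))
    steep : k * m + c ≤ a
    steep = +-cancelʳ-≤ (k + suc b) _ _ (begin
      k * m + c + (k + suc b)  ≡⟨ solve 4 (λ k m c b → k :* m :+ c :+ (k :+ (con 1 :+ b)) := k :* (con 1 :+ m) :+ (c :+ (con 1 :+ b))) refl k m c b ⟩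
      k * ℓ + (c + suc b)      ≤⟨ +-monoˡ-≤ _ wide ⟩
      hook μ c b + (c + suc b) ≡⟨ hook-formula μ corner ⟩
      row μ c + col μ b        ≡⟨ cong₂ _+_ (proj₁ add) (col-removable μ rem) ⟩
      b + k + suc a            ≡⟨ solve 3 (λ b a k → b :+ k :+ (con 1 :+ a) := a :+ (k :+ (con 1 :+ b))) refl b a k ⟩
      a + (k + suc b)          ∎)
      where open +-*-Solver
    0<k : 0 < k
    0<k = +-cancelˡ-< b 0 k (subst (_< b + k) (sym (+-identityʳ b)) b<d)
    c<a : c < a
    c<a = <-≤-trans (+-monoˡ-≤ c (*-mono-≤ 0<k (<-trans z<s 2≤m))) steep
    ladder≤ : c + m * (b + k) ≤ a + m * b
    ladder≤ = begin
      c + m * (b + k)     ≡⟨ solve 4 (λ c m b k → c :+ m :* (b :+ k) := k :* m :+ c :+ m :* b) refl c m b k ⟩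
      k * m + c + m * b   ≤⟨ +-monoˡ-≤ (m * b) steep ⟩
      a + m * b           ∎
      where open +-*-Solver
    -- Both boxes can lie on one ladder; the addable one is then higher and is read first.
    same-or-later : Precedes ℓ (c , b + k) (a , b)
    same-or-later with m≤n⇒m<n∨m≡n ladder≤
    ... | inj₁ lt = inj₁ lt
    ... | inj₂ eq = inj₂ (eq , c<a)

-- Listing the letters in ladder order.

removableSite? : ∀ μ p → Dec (RemovableSite μ p)
removableSite? μ (a , b) = (row μ a ≟ suc b) ×-dec (row μ (suc a) ≤? b)

addableSite? : ∀ μ p → Dec (AddableSite μ p)
addableSite? μ (c , d) = (row μ c ≟ d) ×-dec allUpTo? (λ x → d <? row μ x) c

addable? : ∀ μ p → Dec (Addable μ p)
addable? μ p = map′ (AddableSite⇒Addable μ) (λ (ν , adds) → addableSite {μ} {ν} adds) (addableSite? μ p)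

removable? : ∀ μ p → Dec (Removable μ p)
removable? μ p = map′ (RemovableSite⇒Removable μ) (λ (ν , adds) → removableSite {ν} {μ} adds) (removableSite? μ p)

row-nonzero⇒<length : ∀ μ {a} → 0 < row μ a → a < length (parts μ)
row-nonzero⇒<length μ 0<r = ≰⇒> λ n≤a → <⇒≢ 0<r (sym (nth-beyond (parts μ) n≤a))

-- One row and one column larger than the diagram's bounding rectangle, because addable positions
-- lie just outside.
box : Partition → List Position
box μ = cartesianProduct (upTo (suc (length (parts μ)))) (upTo (suc (row μ 0)))

addable∈box : ∀ μ p → Addable μ p → p ∈ box μ
addable∈box μ (c , d) (ν , adds) with end , above ← addableSite {μ} {ν} adds =
  ∈-cartesianProduct⁺
    (∈-upTo⁺ (s≤s (≮⇒≥ λ n<c → <⇒≱ (above n<c) (≤-trans (≤-reflexive (nth-beyond (parts μ) ≤-refl)) z≤n))))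
    (∈-upTo⁺ (s≤s (subst (_≤ row μ 0) end (row-antitone μ z≤n))))

removable∈box : ∀ μ p → Removable μ p → p ∈ box μ
removable∈box μ (a , b) (ν , adds) with end , _ ← removableSite {ν} {μ} adds =
  ∈-cartesianProduct⁺
    (∈-upTo⁺ (m<n⇒m<1+n (row-nonzero⇒<length μ (subst (0 <_) (sym end) z<s))))
    (∈-upTo⁺ (m<n⇒m<1+n (≤-trans (≤-reflexive (sym end)) (row-antitone μ z≤n))))

Precedes-irrefl : ∀ ℓ {p} → ¬ Precedes ℓ p p
Precedes-irrefl ℓ (inj₁ p<p)       = <-irrefl refl p<p
Precedes-irrefl ℓ (inj₂ (_ , p<p)) = <-irrefl refl p<p

++⁻ʳ : ∀ {A : Set} {R : A → A → Set} ps {qs} → AllPairs R (ps ++ qs) → AllPairs R qs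
++⁻ʳ []       s       = s
++⁻ʳ (_ ∷ ps) (_ ∷ s) = ++⁻ʳ ps s

module SortPositions (m : ℕ) .{{_ : NonZero m}} where

  private
    _≺_ : Position → Position → Set
    _≺_ = Precedes (suc m)

  ≺-trans : ∀ {p q r} → p ≺ q → q ≺ r → p ≺ r
  ≺-trans (inj₁ a)       (inj₁ b)       = inj₁ (<-trans a b)
  ≺-trans (inj₁ a)       (inj₂ (e , _)) = inj₁ (<-≤-trans a (≤-reflexive e))
  ≺-trans (inj₂ (e , _)) (inj₁ b)       = inj₁ (≤-<-trans (≤-reflexive e) b)
  ≺-trans (inj₂ (e , a)) (inj₂ (f , b)) = inj₂ (trans e f , <-trans a b)

  ≺-compare : ∀ p q → p ≺ q ⊎ p ≡ q ⊎ q ≺ p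
  ≺-compare p@(a , b) q@(c , d) with <-cmp (ladder (suc m) p) (ladder (suc m) q) | <-cmp a c
  ... | tri< l _ _  | _             = inj₁ (inj₁ l)
  ... | tri> _ _ l  | _             = inj₂ (inj₂ (inj₁ l))
  ... | tri≈ _ e _  | tri< l _ _    = inj₁ (inj₂ (e , l))
  ... | tri≈ _ e _  | tri> _ _ l    = inj₂ (inj₂ (inj₂ (sym e , l)))
  -- On one ladder the row determines the column, as m is nonzero; hence the order is total.
  ... | tri≈ _ e _  | tri≈ _ refl _ = inj₂ (inj₁ (cong (a ,_) (*-cancelˡ-≡ b d m (+-cancelˡ-≡ a _ _ e))))

  insert : ∀ p {qs} → AllPairs _≺_ qs → ∃[ rs ] (AllPairs _≺_ rs × ∀ r → r ∈ rs ⇔ r ∈ p ∷ qs)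
  insert p []  = [ p ] , [] ∷ [] , λ r → mk⇔ (λ h → h) (λ h → h)
  insert p {q ∷ qs} (q≺qs ∷ s) with ≺-compare p q
  ... | inj₁ p≺q         = p ∷ q ∷ qs , (p≺q ∷ All.map (≺-trans p≺q) q≺qs) ∷ q≺qs ∷ s , λ r → mk⇔ (λ h → h) (λ h → h)
  ... | inj₂ (inj₁ refl) = q ∷ qs , q≺qs ∷ s , λ r → mk⇔ there λ { (here e) → here e ; (there h) → h }
  ... | inj₂ (inj₂ q≺p) with rs , rs-sorted , ∈rs ← insert p s =
    q ∷ rs , All.tabulate (λ {r} h → first (to (∈rs r) h)) ∷ rs-sorted , λ r → mk⇔ (fwd r) (bwd r)
    where
    first : ∀ {r} → r ∈ p ∷ qs → q ≺ r
    first (here refl) = q≺p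
    first (there h)   = All.lookup q≺qs h
    fwd : ∀ r → r ∈ q ∷ rs → r ∈ p ∷ q ∷ qs
    fwd r (here e) = there (here e)
    fwd r (there h) with to (∈rs r) h
    ... | here e   = here e
    ... | there h′ = there (there h′)
    bwd : ∀ r → r ∈ p ∷ q ∷ qs → r ∈ q ∷ rs
    bwd r (here e)          = there (from (∈rs r) (here e))
    bwd r (there (here e))  = here e
    bwd r (there (there h)) = there (from (∈rs r) (there h))

  sort : ∀ ps → ∃[ qs ] (AllPairs _≺_ qs × ∀ q → q ∈ qs ⇔ q ∈ ps)
  sort [] = [] , [] , λ q → mk⇔ (λ h → h) (λ h → h)
  sort (p ∷ ps) with qs , qs-sorted , ∈qs ← sort ps with rs , rs-sorted , ∈rs ← insert p qs-sorted =
    rs , rs-sorted , λ r → mk⇔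
      (λ h → case-to r (to (∈rs r) h))
      (λ { (here e) → from (∈rs r) (here e) ; (there h) → from (∈rs r) (there (from (∈qs r) h)) })
    where
    case-to : ∀ r → r ∈ p ∷ qs → r ∈ p ∷ ps
    case-to r (here e)  = here e
    case-to r (there h) = there (to (∈qs r) h)

  enumerate : ∀ {P : Position → Set} → Decidable P → ∀ ps → (∀ p → P p → p ∈ ps) →
    ∃[ qs ] (AllPairs _≺_ qs × ∀ q → q ∈ qs ⇔ P q)
  enumerate P? ps bounded with qs , qs-sorted , ∈qs ← sort (filter P? ps) =
    qs , qs-sorted , λ q → mk⇔
      (λ h → proj₂ (∈-filter⁻ P? {xs = ps} (to (∈qs q) h)))
      (λ h → from (∈qs q) (∈-filter⁺ P? (bounded q h) h))

-- Words in which nothing cancels.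

labelled : Sign → List Position → Word
labelled s = map (s ,_)

word : List Position → List Position → Word
word ps qs = labelled Sign.+ ps ++ labelled Sign.- qs

labelled-positions : ∀ (s : Sign) ps → map proj₂ (labelled s ps) ≡ ps
labelled-positions s []       = refl
labelled-positions s (p ∷ ps) = cong (p ∷_) (labelled-positions s ps)

word-positions : ∀ ps qs → map proj₂ (word ps qs) ≡ ps ++ qs
word-positions ps qs = trans (map-++ proj₂ (labelled Sign.+ ps) (labelled Sign.- qs))
  (cong₂ _++_ (labelled-positions Sign.+ ps) (labelled-positions Sign.- qs))

all-minus : ∀ qs → All (λ s → proj₁ s ≡ Sign.-) (labelled Sign.- qs)
all-minus qs = All.map⁺ (All.tabulate λ _ → refl)

+∈word : ∀ ps qs p → (Sign.+ , p) ∈ word ps qs ⇔ p ∈ ps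
+∈word ps qs p = mk⇔ fwd (∈-++⁺ˡ ∘ ∈-map⁺ _)
  where
  fwd : (Sign.+ , p) ∈ word ps qs → p ∈ ps
  fwd h with ∈-++⁻ (labelled Sign.+ ps) h
  ... | inj₁ h′ with _ , k , refl ← ∈-map⁻ _ h′ = k
  ... | inj₂ h′ with _ , _ , () ← ∈-map⁻ _ h′

-∈word : ∀ ps qs p → (Sign.- , p) ∈ word ps qs ⇔ p ∈ qs
-∈word ps qs p = mk⇔ fwd (∈-++⁺ʳ (labelled Sign.+ ps) ∘ ∈-map⁺ _)
  where
  fwd : (Sign.- , p) ∈ word ps qs → p ∈ qs
  fwd h with ∈-++⁻ (labelled Sign.+ ps) h
  ... | inj₁ h′ with _ , _ , () ← ∈-map⁻ _ h′
  ... | inj₂ h′ with _ , k , refl ← ∈-map⁻ _ h′ = k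

word-irreducible : ∀ ps qs r → ¬ (word ps qs ↝ r)
word-irreducible ps qs r step = go ps refl step
  where
  no-minus-plus : ∀ ps u {p q v} → word ps qs ≢ u ++ (Sign.- , p) ∷ (Sign.+ , q) ∷ v
  no-minus-plus [] u eq with _ ∷ () ∷ _ ← All.++⁻ʳ u (subst (All _) eq (all-minus qs))
  no-minus-plus (_ ∷ ps) []      ()
  no-minus-plus (_ ∷ ps) (_ ∷ u) eq = no-minus-plus ps u (proj₂ (∷-injective eq))
  go : ∀ ps {w} → w ≡ word ps qs → ¬ (w ↝ r)
  go ps eq (cancel u v) = no-minus-plus ps u (sym eq)

-- How removing an i-box changes the signature.

module Ladder (ℓ : ℕ) (2≤ℓ : 2 ≤ ℓ) (i : Fin ℓ) where
  open Congruence ℓ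

  ι : ℤ
  ι = ℤ.+ toℕ i

  residue? : ∀ p → Dec (HasResidue ℓ i p)
  residue? (a , b) = ℓ ∣? ℤ.∣ (ℤ.+ b ℤ.- ℤ.+ a) ℤ.- ι ∣

  content-right : ∀ a b → content (a , suc b) ≡ ℤ.suc (content (a , b))
  content-right a b = ℤ.+-assoc 1ℤ (ℤ.+ b) (ℤ.- (ℤ.+ a))

  right-residue : ∀ a b → HasResidue ℓ i (a , b) → ¬ HasResidue ℓ i (a , suc b)
  right-residue a b h k = suc≉ 2≤ℓ {content (a , b)} (mk≈ h) (subst (_≈ ι) (content-right a b) (mk≈ k))

  below-residue : ∀ a b → HasResidue ℓ i (a , b) → ¬ HasResidue ℓ i (suc a , b)
  below-residue a b h k = pred≉ 2≤ℓ {content (a , b)} (mk≈ h) (subst (_≈ ι) (minus-suc b a) (mk≈ k))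

  module _ {μ ν q} (adds : AddsBox μ q ν) (q-res : HasResidue ℓ i q) where

    private
      a = proj₁ q
      μ-end   = proj₁ (addableSite {μ} {ν} adds)
      ν-end   = proj₁ (removableSite {μ} {ν} adds)
      ν-below = proj₂ (removableSite {μ} {ν} adds)

      other : ∀ {x} → x ≢ a → row ν x ≡ row μ x
      other = other-rows {μ} {ν} adds _

    -- The two boxes next to q have residues other than i, so removing q leaves
    -- the other i-boxes alone.
    addable-after : ∀ p → HasResidue ℓ i p → Addable μ p ⇔ (Addable ν p ⊎ p ≡ q)
    addable-after p@(c , d) p-res = mk⇔ fwd bwd
      where
      fwd : Addable μ p → Addable ν p ⊎ p ≡ q
      fwd (κ , adds′) with end , above ← addableSite {μ} {κ} adds′ with c ≟ a
      ... | yes refl = inj₂ (cong (c ,_) (trans (sym end) μ-end))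
      ... | no c≢a   = inj₁ (AddableSite⇒Addable ν (trans (other c≢a) end , old⊆ {μ} {ν} adds _ ∘ above))
      bwd : Addable ν p ⊎ p ≡ q → Addable μ p
      bwd (inj₂ refl) = ν , adds
      bwd (inj₁ (κ , adds′)) with end , above ← addableSite {ν} {κ} adds′ with c ≟ a
      ... | yes refl = contradiction (subst (λ x → HasResidue ℓ i (c , x)) (trans (sym end) ν-end) p-res) (right-residue c _ q-res)
      ... | no c≢a   = AddableSite⇒Addable μ (trans (sym (other c≢a)) end , λ x<c → ≢new⇒old {μ} {ν} adds _ (above x<c) (not-q x<c))
        where
        -- If `q` were above `p` in its column, then either the row below `q` reaches that column,
        -- so `q` is not removable, or `p` touches `q` from below and has another residue.
        not-q : ∀ {x} → x < c → (x , d) ≢ q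
        not-q x<c refl with m≤n⇒m<n∨m≡n x<c
        ... | inj₁ sx<c = <⇒≱ (above sx<c) ν-below
        ... | inj₂ refl = below-residue _ d q-res p-res

    removable-after : ∀ p → HasResidue ℓ i p → Removable μ p ⇔ (Removable ν p × p ≢ q)
    removable-after p@(c , d) p-res = mk⇔ fwd bwd
      where
      fwd : Removable μ p → Removable ν p × p ≢ q
      fwd (κ , adds′) with end , below ← removableSite {κ} {μ} adds′ with c ≟ a
      ... | yes refl = contradiction (subst (λ x → HasResidue ℓ i (c , x)) (trans (sym μ-end) end) q-res) (right-residue c _ p-res)
      ... | no c≢a   = RemovableSite⇒Removable ν (trans (other c≢a) end , below′) , c≢a ∘ cong proj₁
        where
        below′ : row ν (suc c) ≤ d
        below′ = ≮⇒≥ λ d<r → <⇒≱ (≢new⇒old {μ} {ν} adds (suc c , d) d<r λ { refl → below-residue _ d p-res q-res }) below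
      bwd : Removable ν p × p ≢ q → Removable μ p
      bwd ((κ , adds′) , p≢q) with end , below ← removableSite {κ} {ν} adds′ with c ≟ a
      ... | yes refl = contradiction (cong (c ,_) (suc-injective (trans (sym end) ν-end))) p≢q
      ... | no c≢a   = RemovableSite⇒Removable μ (trans (sym (other c≢a)) end ,
                         ≮⇒≥ λ d<r → <⇒≱ (old⊆ {μ} {ν} adds (suc c , d) d<r) below)

  record Letters (μ : Partition) (ps qs : List Position) : Set where
    field
      ordered : AllPairs (Precedes ℓ) (ps ++ qs)
      plus    : ∀ p → p ∈ ps ⇔ (HasResidue ℓ i p × Addable μ p)
      minus   : ∀ p → p ∈ qs ⇔ (HasResidue ℓ i p × Removable μ p)

  open Letters

  signature : ∀ {μ ps qs} → Letters μ ps qs → IsSignature ℓ i μ (word ps qs)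
  signature {μ} {ps} {qs} L = record
    { ordered = AllPairs.map⁻ (subst (AllPairs (Precedes ℓ)) (sym (word-positions ps qs)) (ordered L))
    ; plus    = λ p → plus L p ⇔-∘ +∈word ps qs p
    ; minus   = λ p → minus L p ⇔-∘ -∈word ps qs p
    }

  Letters-remove : ∀ {μ ν ps q qs} → Letters ν ps (q ∷ qs) → AddsBox μ q ν →
    Letters μ (ps ++ [ q ]) qs
  Letters-remove {μ} {ν} {ps} {q} {qs} L adds = record
    { ordered = subst (AllPairs (Precedes ℓ)) (sym (++-assoc ps [ q ] qs)) (ordered L)
    ; plus    = λ p → mk⇔ (plus-to p) (plus-from p)
    ; minus   = λ p → mk⇔ (minus-to p) (minus-from p)
    }
    where
    q-res : HasResidue ℓ i q
    q-res = proj₁ (to (minus L q) (here refl))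

    q∉qs : q ∉ qs
    q∉qs q∈qs with q≺qs ∷ _ ← ++⁻ʳ ps (ordered L) = Precedes-irrefl ℓ (All.lookup q≺qs q∈qs)

    plus-to : ∀ p → p ∈ ps ++ [ q ] → HasResidue ℓ i p × Addable μ p
    plus-to p h with ∈-++⁻ ps h
    ... | inj₁ p∈ps with res , add ← to (plus L p) p∈ps = res , from (addable-after {μ} {ν} adds q-res p res) (inj₁ add)
    ... | inj₂ (here refl) = q-res , ν , adds

    plus-from : ∀ p → HasResidue ℓ i p × Addable μ p → p ∈ ps ++ [ q ]
    plus-from p (res , add) with to (addable-after {μ} {ν} adds q-res p res) add
    ... | inj₁ add′ = ∈-++⁺ˡ (from (plus L p) (res , add′))
    ... | inj₂ refl = ∈-++⁺ʳ ps (here refl)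

    minus-to : ∀ p → p ∈ qs → HasResidue ℓ i p × Removable μ p
    minus-to p h with res , rem ← to (minus L p) (there h) =
      res , from (removable-after {μ} {ν} adds q-res p res) (rem , λ { refl → q∉qs h })

    minus-from : ∀ p → HasResidue ℓ i p × Removable μ p → p ∈ qs
    minus-from p (res , rem) with rem′ , p≢q ← to (removable-after {μ} {ν} adds q-res p res) rem
      with from (minus L p) (res , rem′)
    ... | here p≡q = contradiction p≡q p≢q
    ... | there h  = h

  f̂-last-plus : ∀ {μ ν ps q qs} → Letters μ (ps ++ [ q ]) qs → AddsBox μ q ν → f̂ ℓ i μ ν
  f̂-last-plus {ps = ps} {q} {qs} L adds =
    word (ps ++ [ q ]) qs , q ,
    (word (ps ++ [ q ]) qs , signature L , ε , word-irreducible (ps ++ [ q ]) qs) ,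
    (labelled Sign.+ ps , labelled Sign.- qs , split , all-minus qs) , adds
    where
    split : word (ps ++ [ q ]) qs ≡ labelled Sign.+ ps ++ (Sign.+ , q) ∷ labelled Sign.- qs
    split = trans (cong (_++ labelled Sign.- qs) (map-++ (Sign.+ ,_) ps [ q ])) (++-assoc (labelled Sign.+ ps) _ _)

  Step : Partition → Partition → Set
  Step μ ν = ∃[ j ] f̂ ℓ j μ ν

  -- `X` remains the bead set at the start, which lets the JM transfer compare both ends directly.
  -- The size bound feeds the induction.
  remove-all : ∀ {X} → (∀ z → Dec (X z)) → ∀ {ν ps} qs → Letters ν ps qs → Sorts ι X (Beads ν) →
    ∃[ μ ] ∃[ ps′ ] (Letters μ ps′ [] × Sorts ι X (Beads μ) × Star Step μ ν × length qs + size μ ≤ size ν)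
  remove-all X? {ν} {ps} [] L s = ν , ps , L , s , ε , ≤-refl
  remove-all X? {ν} (q ∷ qs) L s
    with q-res , κ , adds ← to (minus L q) (here refl)
    with L′ ← Letters-remove {κ} {ν} L adds
    with μ , ps′ , L″ , s′ , steps , le ← remove-all X? qs L′ (Sorts-remove ℓ 2≤ℓ {μ = κ} {ν} X? adds (mk≈ q-res) s)
    -- Crystal steps add boxes, so the first box removed gives the last step of the path.
    = μ , ps′ , L″ , s′ , steps ◅◅ (i , f̂-last-plus {κ} {ν} L′ adds) ◅ ε , ≤-trans (s≤s le) (size-< {κ} {ν} adds)

-- The induction on size.

residueOf : ∀ ℓ .{{_ : NonZero ℓ}} p → ∃[ i ] HasResidue ℓ i p
residueOf ℓ p@(a , b) = fromℕ< r<ℓ , Signed.∣⇒∣ᵤ (Signed.divides (c ℤ./ℕ ℓ) (begin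
    c ℤ.- ℤ.+ toℕ (fromℕ< r<ℓ)                              ≡⟨ cong (λ r → c ℤ.- ℤ.+ r) (toℕ-fromℕ< r<ℓ) ⟩
    c ℤ.- ℤ.+ (c ℤ.%ℕ ℓ)                                    ≡⟨ cong (ℤ._- ℤ.+ (c ℤ.%ℕ ℓ)) (ℤ.a≡a%ℕn+[a/ℕn]*n c ℓ) ⟩
    (ℤ.+ (c ℤ.%ℕ ℓ) ℤ.+ (c ℤ./ℕ ℓ) ℤ.* ℤ.+ ℓ) ℤ.- ℤ.+ (c ℤ.%ℕ ℓ) ≡⟨ add-sub (ℤ.+ (c ℤ.%ℕ ℓ)) _ ⟩
    (c ℤ./ℕ ℓ) ℤ.* ℤ.+ ℓ                                     ∎))
  where
  open ≡-Reasoning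
  c = content p
  r<ℓ = ℤ.n%ℕd<d c ℓ
  add-sub : ∀ r q → (r ℤ.+ q) ℤ.- r ≡ q
  add-sub = solve-∀

removable-exists : ∀ μ → 0 < length (parts μ) → ∃[ p ] Removable μ p
removable-exists μ@(mkPartition (x ∷ xs) _ 0<parts) _ with a , lt ← strict-descent x xs 0<parts
  with row μ a in end | lt
... | suc b | s≤s below = (a , b) , RemovableSite⇒Removable μ (end , below)

module _ {m} (2≤m : 2 ≤ m) where

  private
    ℓ₀ = suc m
    2≤ℓ : 2 ≤ ℓ₀
    2≤ℓ = m≤n⇒m≤1+n 2≤m
    instance
      m≢0 : NonZero m
      m≢0 = >-nonZero (<-trans z<s 2≤m)
  open Congruence ℓ₀
  open SortPositions m using (enumerate)

  JM-letters : ∀ μ → IsJM ℓ₀ μ → ∀ i → ∃[ ps ] ∃[ qs ] Ladder.Letters ℓ₀ 2≤ℓ i μ ps qs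
  JM-letters μ jm i
    with ps , ps-sorted , ∈ps ← enumerate (λ p → Ladder.residue? ℓ₀ 2≤ℓ i p ×-dec addable? μ p) (box μ) (λ p → addable∈box μ p ∘ proj₂)
    with qs , qs-sorted , ∈qs ← enumerate (λ p → Ladder.residue? ℓ₀ 2≤ℓ i p ×-dec removable? μ p) (box μ) (λ p → removable∈box μ p ∘ proj₂)
    = ps , qs , record
      { ordered = AllPairs.++⁺ ps-sorted qs-sorted (All.tabulate λ {p} p∈ → All.tabulate λ {q} q∈ → before (to (∈ps p) p∈) (to (∈qs q) q∈))
      ; plus    = ∈ps
      ; minus   = ∈qs
      }
    where
    before : ∀ {p q} → HasResidue ℓ₀ i p × Addable μ p → HasResidue ℓ₀ i q × Removable μ q → Precedes ℓ₀ p q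
    before {p} {q} (p-res , ν , adds) (q-res , κ , adds′) =
      addable-precedes-removable 2≤m μ jm (addableSite {μ} {ν} adds) (removableSite {κ} {μ} adds′)
        (≈-trans {content p} (mk≈ p-res) (≈-sym {content q} (mk≈ q-res)))

  JM-node : ∀ n μ → size μ ≡ n → IsJM ℓ₀ μ → IsLadderNode ℓ₀ μ
  JM-node = <-rec _ step
    where
    step : ∀ n → (∀ {k} → k < n → ∀ μ → size μ ≡ k → IsJM ℓ₀ μ → IsLadderNode ℓ₀ μ) →
      ∀ μ → size μ ≡ n → IsJM ℓ₀ μ → IsLadderNode ℓ₀ μ
    step n rec (mkPartition [] [] []) _ _ = ε
    step n rec μ@(mkPartition (x ∷ xs) _ _) refl jm
      -- The residue is taken from an actual removable box, so `qs` is nonempty and the size drops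
      -- strictly.
      with p , rem ← removable-exists μ z<s
      with i , p-res ← residueOf ℓ₀ p
      with ps , qs , L ← JM-letters μ jm i
      with p∈qs ← from (Ladder.Letters.minus L p) (p-res , rem)
      with κ , ps′ , L′ , s , steps , le ← Ladder.remove-all ℓ₀ 2≤ℓ i (bead? μ) qs L Sorts-refl
      = rec (<-≤-trans (m<n+m (size κ) (nonempty p∈qs)) le) κ refl
          (MayaJM⇒IsJM ℓ₀ κ (MayaJM-sort 2≤ℓ (bead? μ) s
            (no-removable⇒sorted ℓ₀ κ (no-removable L′)) (IsJM⇒MayaJM ℓ₀ μ jm)))
        ◅◅ steps
      where
      nonempty : ∀ {p} {qs : List Position} → p ∈ qs → 0 < length qs
      nonempty (here _)  = z<s
      nonempty (there _) = z<s
      no-removable : ∀ {i κ ps′} → Ladder.Letters ℓ₀ 2≤ℓ i κ ps′ [] → ∀ p → content p ≈ Ladder.ι ℓ₀ 2≤ℓ i → ¬ Removable κ p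
      no-removable L′ p p≈i rem with () ← from (Ladder.Letters.minus L′ p) (divisible p≈i , rem)

theorem3p7p4p1 : (ℓ : ℕ) → 3 ≤ ℓ → (μ : Partition) → IsJM ℓ μ → IsLadderNode ℓ μ
theorem3p7p4p1 (suc m) (s≤s 2≤m) μ = JM-node 2≤m _ μ refl
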